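{- For any integer $s\geq 6$, we have $r'_2(s)\leq \left\lceil\frac{13}{48}2^s\right\rceil$.
   Context: All graphs are finite and simple. A threshold graph of order $s$ is an $s$-vertex graph that can be constructed from the one-vertex graph by repeatedly adding a new vertex that is either adjacent to all the previous vertices or nonadjacent to all the previous vertices. For a positive integer $s$, $r'_2(s)$ is the minimum integer $n$ such that every $n$-vertex graph contains a threshold graph of order $s$ as an induced subgraph. -}

module Defs where

open import Data.Bool.Base using (Bool; false)
open import Data.Fin.Base using (Fin; zero; suc)
open import Data.Nat.Base using (ℕ; suc; _≤_)
open import Data.Product.Base using (Σ-syntax; ∃-syntax; _×_)
open import Function.Bundles using (_↔_; _↣_; Inverse; Injection)
open import Relation.Binary.PropositionalEquality.Core using (_≡_; refl)

record Graph (n : ℕ) : Set where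
  field
    adj    : Fin n → Fin n → Bool
    symm   : ∀ i j → adj i j ≡ adj j i
    irrefl : ∀ i → adj i i ≡ false

open Graph public

_≅_ : ∀ {n} → Graph n → Graph n → Set
_≅_ {n} G H =
  Σ[ φ ∈ Fin n ↔ Fin n ]
    (∀ i j → adj H (Inverse.to φ i) (Inverse.to φ j) ≡ adj G i j)

-- H embeds in G as an induced subgraph: adjacency is both preserved and
-- reflected, since it is compared as an equality of Booleans.
_InducedIn_ : ∀ {s n} → Graph s → Graph n → Set
_InducedIn_ {s} {n} H G =
  Σ[ ι ∈ Fin s ↣ Fin n ]
    (∀ i j → adj G (Injection.to ι i) (Injection.to ι j) ≡ adj H i j)

K₁ : Graph 1
K₁ .adj    _ _ = false
K₁ .symm   _ _ = refl
K₁ .irrefl _   = refl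

-- The new vertex is zero; it is adjacent to all the old vertices if b is
-- true and to none of them if b is false.
addVertex : ∀ {n} → Bool → Graph n → Graph (suc n)
addVertex b G .adj zero    zero    = false
addVertex b G .adj zero    (suc _) = b
addVertex b G .adj (suc _) zero    = b
addVertex b G .adj (suc i) (suc j) = adj G i j
addVertex b G .symm zero    zero    = refl
addVertex b G .symm zero    (suc _) = refl
addVertex b G .symm (suc _) zero    = refl
addVertex b G .symm (suc i) (suc j) = symm G i j
addVertex b G .irrefl zero    = refl
addVertex b G .irrefl (suc i) = irrefl G i

-- Closure under isomorphism is needed because the vertices of a Graph are
-- labelled, whereas a construction order may visit them in any order.
data IsThreshold : ∀ {s} → Graph s → Set where
  single : IsThreshold K₁
  extend : ∀ {s} {G : Graph s} (b : Bool) →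
           IsThreshold G → IsThreshold (addVertex b G)
  iso    : ∀ {s} {G H : Graph s} → G ≅ H → IsThreshold G → IsThreshold H

ContainsThreshold : ∀ {n} → ℕ → Graph n → Set
ContainsThreshold s G = ∃[ H ] (IsThreshold {s} H × H InducedIn G)

IsMinimum : (ℕ → Set) → ℕ → Set
IsMinimum P n = P n × (∀ m → P m → n ≤ m)

-- Reads n = r₂′(s): the function r₂′ is presented as a relation, which is
-- single-valued because a minimum is unique.
_IsR₂′Of_ : ℕ → ℕ → Set
n IsR₂′Of s = IsMinimum (λ m → (G : Graph m) → ContainsThreshold s G) n

{-# OPTIONS --safe #-}

-- Write r for r₂′. Every vertex has, apart from itself, n - 1 vertices split
-- into neighbours and non-neighbours, so r (s + 1) ≤ 2 r(s); if r(s) is even,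
-- the handshake lemma improves this to 2 r(s) - 1. Starting from r(6) ≤ 18 this
-- gives the stated ceiling for all s ≥ 6.
--
-- A 9-vertex graph without a threshold graph of order 5 contains no induced
-- pentagon (by exhaustive search), i.e. no 5 vertices without a threshold
-- graph of order 4, and therefore is 4-regular; likewise r(5) ≤ 10. Suppose
-- that an 18-vertex graph has no threshold graph of order 6. All degrees, also
-- in the complement, are then at most 9, so up to complementation some vertex v
-- has a set R of exactly 9 neighbours, hence 8 non-neighbours. Each
-- non-neighbour w misses at most 4 vertices of R, since those it misses have no
-- threshold graph of order 4, to which v and then w could be added; so it is
-- adjacent to at least 5. But a vertex of R has degree at most 9, of which v
-- and R take 5, leaving at most 4 non-neighbours of v. Counting edges
-- gives 8 · 5 ≤ 9 · 4, a contradiction.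
module Submission where

open import Defs
open import Algebra.Properties.CommutativeSemigroup using (x∙yz≈y∙xz)
open import Data.Bool.Base using (Bool; true; false; not; _∧_; _∨_; if_then_else_; T)
open import Data.Bool.ListAction using (any)
open import Data.Bool.Properties as Bool using (T-∧; T-∨; T?)
open import Data.Empty using (⊥; ⊥-elim)
open import Data.Fin.Base using (Fin; zero; suc; toℕ; combine; remQuot)
open import Data.Fin using (#_)
import Data.Fin.Properties as Fin
open import Data.Fin.Subset using (Subset)
open import Data.Fin.Subset.Properties using (anySubset?)
open import Data.Integer.Base as ℤ using (ℤ; +_)
import Data.Integer.DivMod as ℤ
import Data.Integer.Properties as ℤ
open import Data.List.Base as List using (List; []; _∷_; _++_; take; map; concatMap; filter; filterᵇ; length; allFin; foldr)
open import Data.List.Membership.Propositional using (_∈_; _∉_; find)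
open import Data.List.Membership.Propositional.Properties using (∈-filter⁺; ∈-filter⁻; ∈-map⁺; ∈-map⁻; ∈-lookup; ∈-++⁺ˡ; ∈-allFin)
open import Data.List.Properties using (length-map; length-tabulate; length-take; take++drop≡id; filter-reject; filter-all)
open import Data.List.Relation.Binary.Subset.Propositional using (_⊆_)
open import Data.List.Relation.Binary.Subset.Propositional.Properties using (filter⁺′; filter-⊆)
open import Data.List.Relation.Unary.All as All using (All; []; _∷_)
import Data.List.Relation.Unary.All.Properties as All
open import Data.List.Relation.Unary.AllPairs using ([]; _∷_)
open import Data.List.Relation.Unary.Any as Any using (Any; here; there)
import Data.List.Relation.Unary.Any.Properties as Any
open import Data.List.Relation.Unary.Unique.DecPropositional (Fin._≟_ {9}) using (unique?)
open import Data.List.Relation.Unary.Unique.Propositional using (Unique)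
import Data.List.Relation.Unary.Unique.Propositional.Properties as Unique
open import Data.Maybe.Base using (Maybe; just; nothing)
import Data.Maybe.Relation.Unary.All as Maybe
open import Data.Nat.Base using (ℕ; zero; suc; _+_; _*_; _^_; _≤_; _<_; _<ᵇ_; z≤n; s≤s)
open import Data.Nat.Divisibility using (_∣_; divides; ∣1⇒≡1; ∣m+n∣m⇒∣n; ∣m∣n⇒∣m+n; ∣m⇒∣m*n)
open import Data.Nat.Induction using (<-rec)
open import Data.Nat.Properties
open import Data.Nat.Solver using (module +-*-Solver)
open import Data.Product.Base using (∃-syntax; _×_; _,_; proj₁; proj₂; uncurry)
open import Data.Rational.Unnormalised.Base as ℚᵘ using (_/_; ceiling)
open import Data.Sum.Base using (_⊎_; inj₁; inj₂; [_,_]′)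
open import Data.Unit.Base using (⊤; tt)
open import Data.Vec.Base using (Vec; []; _∷_; lookup; tabulate; updateAt; replicate)
open import Data.Vec.Properties using (lookup∘tabulate; lookup-replicate)
open import Function.Base using (const; flip; id; _∘_)
open import Function.Bundles using (Equivalence; Inverse; Injection; mk↣; mk⇔)
open import Function.Properties.Inverse using (↔⇒↣)
open import Relation.Binary.Definitions using (DecidableEquality)
open import Relation.Binary.PropositionalEquality
open import Relation.Nullary using (¬_; Dec; yes; no; contradiction)
open import Relation.Nullary.Decidable using (does; does-⇔; dec-true; decidable-stable; from-yes; map′; ¬?; _×-dec_; _⊎-dec_)
open +-*-Solver using (solve; _:+_; _:*_; _:=_; con)

-- Auxiliary facts on lists, vectors and Booleans.

lookup-injective : ∀ {A : Set} {xs : List A} → Unique xs → ∀ i j →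
                   List.lookup xs i ≡ List.lookup xs j → i ≡ j
lookup-injective (_  ∷ _) zero    zero    _  = refl
lookup-injective (x∉ ∷ _) zero    (suc j) eq = contradiction eq (All.lookup x∉ (∈-lookup j))
lookup-injective (x∉ ∷ _) (suc i) zero    eq = contradiction (sym eq) (All.lookup x∉ (∈-lookup i))
lookup-injective (_  ∷ u) (suc i) (suc j) eq = cong suc (lookup-injective u i j eq)

take-⊆ : ∀ {A : Set} n (xs : List A) → take n xs ⊆ xs
take-⊆ n xs z∈ = subst (_ ∈_) (take++drop≡id n xs) (∈-++⁺ˡ z∈)

filter-comm : ∀ {A : Set} {P Q : A → Set} (P? : ∀ x → Dec (P x)) (Q? : ∀ x → Dec (Q x)) xs →
              filter P? (filter Q? xs) ≡ filter Q? (filter P? xs)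
filter-comm P? Q? []       = refl
filter-comm P? Q? (x ∷ xs) with P? x in p | Q? x in q
... | no  _ | no  _ = filter-comm P? Q? xs
... | no  _ | yes _ rewrite p = filter-comm P? Q? xs
... | yes _ | no  _ rewrite q = filter-comm P? Q? xs
... | yes _ | yes _ rewrite p | q = cong (x ∷_) (filter-comm P? Q? xs)

2∣n+n : ∀ n → 2 ∣ n + n
2∣n+n n = divides n (trans (cong (λ k → n + k) (sym (+-identityʳ n))) (*-comm 2 n))

nonempty : ∀ {A : Set} (xs : List A) → 0 < length xs → ∃[ x ] x ∈ xs
nonempty (x ∷ xs) _ = x , here refl

updateAt-all : ∀ {A : Set} {n} (P : Fin n → A → Set) (r : Vec A n) i {g : A → A} →
               (∀ k → P k (lookup r k)) → P i (g (lookup r i)) →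
               ∀ k → P k (lookup (updateAt r i g) k)
updateAt-all P (x ∷ r) zero    h p zero    = p
updateAt-all P (x ∷ r) zero    h p (suc k) = h (suc k)
updateAt-all P (x ∷ r) (suc i) h p zero    = h zero
updateAt-all P (x ∷ r) (suc i) h p (suc k) =
  updateAt-all (P ∘ suc) r i (h ∘ suc) p k

lookup-blank : ∀ {A : Set} {m n} (i : Fin m) (k : Fin n) →
               lookup (lookup (replicate m (replicate n (nothing {A = A}))) i) k ≡ nothing
lookup-blank {n = n} i k = trans (cong (λ r → lookup r k) (lookup-replicate i (replicate n nothing)))
                                 (lookup-replicate k nothing)

∧-split : ∀ x {y} → T (x ∧ y) → T x × T y
∧-split x = Equivalence.to T-∧

∨-split : ∀ x {y} → T (x ∨ y) → T x ⊎ T y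
∨-split x = Equivalence.to T-∨

-- A search over nine vertices

-- `true` stands for adjacent, `false` for nonadjacent and `nothing` for undecided.
PartialColouring : ℕ → Set
PartialColouring n = Vec (Vec (Maybe Bool) n) n

is : Bool → Maybe Bool → Bool
is true  (just true)  = true
is false (just false) = true
is _     _            = false

is-just : ∀ a m → T (is a m) → m ≡ just a
is-just true  (just true)  _ = refl
is-just false (just false) _ = refl

colour : ∀ {n} → Fin n → Fin n → Bool → PartialColouring n → PartialColouring n
colour i j b M = updateAt (updateAt M i λ r → updateAt r j (const (just b)))
                          j λ r → updateAt r i (const (just b))

count : ∀ {A : Set} {n} → (A → A → Bool) → Vec A n → Vec A n → ℕ
count p []      []      = 0
count p (x ∷ r) (y ∷ s) = if p x y then suc (count p r s) else count p r s

-- `overfull` only compares a number, whereas a chain needs actual distinct vertices; these are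
-- recovered here.
count-witnesses : ∀ {A : Set} {n} (p : A → A → Bool) (r s : Vec A n) →
  ∃[ ks ] (Unique ks × length ks ≡ count p r s ×
           All (λ k → T (p (lookup r k) (lookup s k))) ks)
count-witnesses p []      []      = [] , [] , refl , []
count-witnesses p (x ∷ r) (y ∷ s) with count-witnesses p r s | p x y in eq
... | ks , u , l , h | false =
  map suc ks , Unique.map⁺ Fin.suc-injective u , trans (length-map suc ks) l , All.map⁺ h
... | ks , u , l , h | true  =
  zero ∷ map suc ks
  , All.map⁺ (All.universal (λ _ ()) ks) ∷ Unique.map⁺ Fin.suc-injective u
  , cong suc (trans (length-map suc ks) l)
  , subst T (sym eq) tt ∷ All.map⁺ h

-- Any three vertices form a chain. Hence if u v has colour a, where a is b or c,
-- and three vertices are joined to u in colour b and to v in colour c, then u, v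
-- and these three form a chain of length 5. The rows of u and v are r and s.
overfull : ∀ {n} → Bool → Bool → Bool → (r s : Vec (Maybe Bool) n) → Bool
overfull a b c r s =
  (is a (just b) ∨ is a (just c)) ∧ (2 <ᵇ count (λ x y → is b x ∧ is c y) r s)

-- A newly coloured pair can be the base u v of an overfull configuration or join the base to one of
-- the three vertices. Hence each side of the triangle is tried as the base.
badTriangle : ∀ {n} → Bool → Maybe Bool → Maybe Bool →
              (r s t : Vec (Maybe Bool) n) → Bool
badTriangle a nothing  _        _ _ _ = false
badTriangle a (just _) nothing  _ _ _ = false
badTriangle a (just b) (just c) r s t =
  overfull a b c r s ∨ overfull c a b s t ∨ overfull b a c r t

-- These vertices are assumed not to contain a chain of length 4.
pentagon : List (Fin 9)
pentagon = # 0 ∷ # 1 ∷ # 2 ∷ # 3 ∷ # 4 ∷ []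

pentagon-unique : Unique pentagon
pentagon-unique = from-yes (unique? pentagon)

∈-pentagon : ∀ i → T (toℕ i <ᵇ 5) → i ∈ pentagon
∈-pentagon zero                         _ = here refl
∈-pentagon (suc zero)                   _ = there (here refl)
∈-pentagon (suc (suc zero))             _ = there (there (here refl))
∈-pentagon (suc (suc (suc zero)))       _ = there (there (there (here refl)))
∈-pentagon (suc (suc (suc (suc zero)))) _ = there (there (there (there (here refl))))
∈-pentagon (suc (suc (suc (suc (suc _))))) ()

-- Three vertices joined to a fourth in one colour complete a chain of length 4.
crowded : Bool → Vec (Maybe Bool) 9 → Bool
crowded b r = 2 <ᵇ length (filterᵇ (λ k → is b (lookup r k)) pentagon)

crowdedPair : Bool → Fin 9 → Fin 9 → (r s : Vec (Maybe Bool) 9) → Bool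
crowdedPair a i j r s = (toℕ i <ᵇ 5) ∧ (toℕ j <ᵇ 5) ∧ (crowded a r ∨ crowded a s)

bad : PartialColouring 9 → Fin 9 → Fin 9 → Bool → Bool
bad M i j a = crowdedPair a i j r s ∨
  any (λ k → badTriangle a (lookup r k) (lookup s k) r s (lookup M k)) (allFin 9)
  where
  r = lookup M i
  s = lookup M j

mutual
  -- Backtracking over both colours of each listed pair. An exhausted list yields `false`, because a
  -- colouring of all the pairs has then survived.
  refuted : List (Fin 9 × Fin 9) → PartialColouring 9 → Bool
  refuted []            M = false
  refuted ((i , j) ∷ o) M = refutedBranch i j o M true ∧ refutedBranch i j o M false

  refutedBranch : Fin 9 → Fin 9 → List (Fin 9 × Fin 9) → PartialColouring 9 → Bool → Bool
  refutedBranch i j o M a = bad (colour i j a M) i j a ∨ refuted o (colour i j a M)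

-- The inner five vertices are completed first, then the others are attached one at a time. The pair
-- of 1 and 4 occurs although `nonadjacent` has coloured it; the search recolours it in both ways.
edges : List (Fin 9 × Fin 9)
edges = concatMap (λ (i , js) → map (i ,_) js)
  ( (# 2 , # 1 ∷ [])
  ∷ (# 3 , # 2 ∷ [])
  ∷ (# 4 , # 1 ∷ # 2 ∷ # 3 ∷ [])
  ∷ (# 5 , pentagon)
  ∷ (# 6 , # 5 ∷ pentagon)
  ∷ (# 7 , # 5 ∷ # 6 ∷ pentagon)
  ∷ (# 8 , # 5 ∷ # 6 ∷ # 7 ∷ pentagon)
  ∷ [])

edges-distinct : All (uncurry _≢_) edges
edges-distinct = from-yes (All.all? (λ (i , j) → ¬? (i Fin.≟ j)) edges)

initial : List (Fin 9 × Fin 9 × Bool) → PartialColouring 9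
initial = foldr (λ (i , j , a) → colour i j a) (replicate 9 (replicate 9 nothing))

-- Without a chain of length 4, each of five vertices is joined to exactly two others in each
-- colour. The two starts below distinguish whether vertex 1 is adjacent to one of 3 and 4, which
-- may be exchanged, or to neither.
star : List (Fin 9 × Fin 9 × Bool)
star = (# 0 , # 1 , true) ∷ (# 0 , # 2 , true) ∷ (# 0 , # 3 , false) ∷ (# 0 , # 4 , false) ∷ []

nonadjacent : List (Fin 9 × Fin 9 × Bool)
nonadjacent = (# 1 , # 3 , false) ∷ (# 1 , # 4 , false) ∷ star

adjacent : List (Fin 9 × Fin 9 × Bool)
adjacent = (# 1 , # 3 , true) ∷ star

abstract
  -- Both refutations hold by evaluating the whole search tree.
  adjacent-refuted : refuted edges (initial adjacent) ≡ true
  adjacent-refuted = refl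

  nonadjacent-refuted : refuted edges (initial nonadjacent) ≡ true
  nonadjacent-refuted = refl

-- Chains

module Chains {V : Set} (_≟_ : DecidableEquality V)
              (adj : V → V → Bool) (adj-sym : ∀ x y → adj x y ≡ adj y x) where

  -- Owing to the distinctness, `Joined false` is adjacency in the complement, so both colours obey
  -- the same lemmas.
  Joined : Bool → V → V → Set
  Joined b x y = x ≢ y × adj x y ≡ b

  abstract
    joined? : ∀ b x y → Dec (Joined b x y)
    joined? b x y = ¬? (x ≟ y) ×-dec (adj x y Bool.≟ b)

  joined-sym : ∀ {b x y} → Joined b x y → Joined b y x
  joined-sym (x≢y , e) = x≢y ∘ sym , trans (adj-sym _ _) e

  joined-clash : ∀ b {x y} → Joined b x y → ¬ Joined (not b) x y
  joined-clash b (_ , p) (_ , q) = Bool.not-¬ refl (trans (sym p) q)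

  joined-either : ∀ b {x y} → x ≢ y → Joined b x y ⊎ Joined (not b) x y
  joined-either b {x} {y} x≢y with adj x y Bool.≟ b
  ... | yes p = inj₁ (x≢y , p)
  ... | no ¬p = inj₂ (x≢y , Bool.¬-not ¬p)

  nbrs : Bool → V → List V → List V
  nbrs b x = filter (joined? b x)

  ∈-nbrs⁺ : ∀ {b x y xs} → y ∈ xs → Joined b x y → y ∈ nbrs b x xs
  ∈-nbrs⁺ = ∈-filter⁺ (joined? _ _)

  ∈-nbrs⁻ : ∀ {b x y} xs → y ∈ nbrs b x xs → y ∈ xs × Joined b x y
  ∈-nbrs⁻ xs = ∈-filter⁻ (joined? _ _)

  nbrs-unique : ∀ {xs} b x → Unique xs → Unique (nbrs b x xs)
  nbrs-unique b x = Unique.filter⁺ (joined? b x)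

  nbrs-⊆ : ∀ b x xs → nbrs b x xs ⊆ xs
  nbrs-⊆ b x xs = filter-⊆ (joined? b x) xs

  nbrs-mono : ∀ {b x xs ys} → xs ⊆ ys → nbrs b x xs ⊆ nbrs b x ys
  nbrs-mono = filter⁺′ (joined? _ _) (joined? _ _) id

  -- Chain k xs: for positive k, some k vertices of xs induce a threshold graph,
  -- listed here in the reverse of the order in which they are added.
  Chain : ℕ → List V → Set
  Chain zero    xs = ⊤
  Chain (suc k) xs = Any (λ x → ∃[ b ] Chain k (nbrs b x xs)) xs

  chain-step : ∀ {k xs x} b → x ∈ xs → Chain k (nbrs b x xs) → Chain (suc k) xs
  chain-step {k} {xs} b x∈ c = Any.map (λ { refl → b , c }) x∈

  chain? : ∀ k xs → Dec (Chain k xs)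
  chain? zero    xs = yes tt
  chain? (suc k) xs = Any.any? (λ x → map′ [ true ,_ , false ,_ ]′ split
    (chain? k (nbrs true x xs) ⊎-dec chain? k (nbrs false x xs))) xs
    where
    split : ∀ {x} → ∃[ b ] Chain k (nbrs b x xs) →
            Chain k (nbrs true x xs) ⊎ Chain k (nbrs false x xs)
    split (true  , c) = inj₁ c
    split (false , c) = inj₂ c

  chain-mono : ∀ k {xs ys} → xs ⊆ ys → Chain k xs → Chain k ys
  chain-mono zero    xs⊆ys c = tt
  chain-mono (suc k) xs⊆ys c with x , x∈xs , b , c′ ← find c =
    chain-step b (xs⊆ys x∈xs) (chain-mono k (nbrs-mono xs⊆ys) c′)

  -- Degrees and edge counting.

  degrees-∉ : ∀ b x xs → x ∉ xs →
              length (nbrs b x xs) + length (nbrs (not b) x xs) ≡ length xs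
  degrees-∉ b x []       _ = refl
  degrees-∉ b x (y ∷ xs) x∉
    with ih ← degrees-∉ b x xs (x∉ ∘ there) | joined? b x y | joined? (not b) x y
  ... | yes j | yes j′ = contradiction j′ (joined-clash b j)
  ... | yes _ | no  _  = cong suc ih
  ... | no  _ | yes _  = trans (+-suc _ _) (cong suc ih)
  ... | no ¬j | no ¬j′ = [ flip contradiction ¬j , flip contradiction ¬j′ ]′
                           (joined-either b (x∉ ∘ here))

  nbrs-self : ∀ b x xs → nbrs b x (x ∷ xs) ≡ nbrs b x xs
  nbrs-self b x xs = filter-reject (joined? b x) λ (x≢x , _) → x≢x refl

  degrees : ∀ b {x xs} → Unique xs → x ∈ xs →
            suc (length (nbrs b x xs) + length (nbrs (not b) x xs)) ≡ length xs
  degrees b {x} {.x ∷ xs} u@(_ ∷ _) (here refl)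
    rewrite nbrs-self b x xs | nbrs-self (not b) x xs =
    cong suc (degrees-∉ b x xs (Unique.Unique[x∷xs]⇒x∉xs u))
  degrees b {x} {y ∷ xs} u@(_ ∷ u′) (there x∈)
    with ih ← degrees b u′ x∈ | joined? b x y | joined? (not b) x y
  ... | yes j | yes j′ = contradiction j′ (joined-clash b j)
  ... | yes _ | no  _  = cong suc ih
  ... | no  _ | yes _  = cong suc (trans (+-suc _ _) ih)
  ... | no ¬j | no ¬j′ = [ flip contradiction ¬j , flip contradiction ¬j′ ]′
    (joined-either b λ { refl → Unique.Unique[x∷xs]⇒x∉xs u x∈ })

  -- Ordered pairs are counted, so every edge counts twice when both lists are the same.
  edgeCount : Bool → List V → List V → ℕ
  edgeCount b []       ys = 0
  edgeCount b (x ∷ xs) ys = length (nbrs b x ys) + edgeCount b xs ys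

  edgeCount-[]ʳ : ∀ b xs → edgeCount b xs [] ≡ 0
  edgeCount-[]ʳ b []       = refl
  edgeCount-[]ʳ b (x ∷ xs) = edgeCount-[]ʳ b xs

  edgeCount-∷ʳ : ∀ b xs y ys →
                 edgeCount b xs (y ∷ ys) ≡ length (nbrs b y xs) + edgeCount b xs ys
  edgeCount-∷ʳ b []       y ys = refl
  edgeCount-∷ʳ b (x ∷ xs) y ys with ih ← edgeCount-∷ʳ b xs y ys | joined? b x y | joined? b y x
  ... | yes _ | yes _ = cong suc (trans (cong (λ k → length (nbrs b x ys) + k) ih)
                              (x∙yz≈y∙xz +-commutativeSemigroup (length (nbrs b x ys)) (length (nbrs b y xs)) _))
  ... | no _  | no _  = trans (cong (λ k → length (nbrs b x ys) + k) ih)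
                              (x∙yz≈y∙xz +-commutativeSemigroup (length (nbrs b x ys)) (length (nbrs b y xs)) _)
  ... | yes j | no ¬j = contradiction (joined-sym j) ¬j
  ... | no ¬j | yes j = contradiction (joined-sym j) ¬j

  edgeCount-comm : ∀ b xs ys → edgeCount b xs ys ≡ edgeCount b ys xs
  edgeCount-comm b xs []       = edgeCount-[]ʳ b xs
  edgeCount-comm b xs (y ∷ ys) =
    trans (edgeCount-∷ʳ b xs y ys) (cong (λ k → length (nbrs b y xs) + k) (edgeCount-comm b xs ys))

  -- Prepending `x` adds its degree `d` twice, once as a row and once as a column.
  handshake : ∀ b xs → 2 ∣ edgeCount b xs xs
  handshake b []       = divides 0 refl
  handshake b (x ∷ xs) rewrite nbrs-self b x xs | edgeCount-∷ʳ b xs x xs =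
    subst (2 ∣_) (+-assoc d d _)
      (∣m∣n⇒∣m+n (2∣n+n d) (handshake b xs))
    where d = length (nbrs b x xs)

  edgeCount-≤ : ∀ {b k ys} xs → (∀ {x} → x ∈ xs → length (nbrs b x ys) ≤ k) →
                edgeCount b xs ys ≤ length xs * k
  edgeCount-≤ []       h = z≤n
  edgeCount-≤ (x ∷ xs) h = +-mono-≤ (h (here refl)) (edgeCount-≤ xs (h ∘ there))

  edgeCount-≥ : ∀ {b k ys} xs → (∀ {x} → x ∈ xs → k ≤ length (nbrs b x ys)) →
                length xs * k ≤ edgeCount b xs ys
  edgeCount-≥ []       h = z≤n
  edgeCount-≥ (x ∷ xs) h = +-mono-≤ (h (here refl)) (edgeCount-≥ xs (h ∘ there))

  -- Quantifying over lists of vertices of one fixed graph lets a bound apply directly to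
  -- neighbourhoods. For positive `k`, having this in every graph means r(k) ≤ n.
  Unavoidable : ℕ → ℕ → Set
  Unavoidable k n = ∀ xs → Unique xs → n ≤ length xs → Chain k xs

  -- A larger neighbourhood would contain a chain, which `x` would extend.
  degree-≤ : ∀ {k n} → Unavoidable k (suc n) → ∀ {xs} → Unique xs → ¬ Chain (suc k) xs →
             ∀ b {x} → x ∈ xs → length (nbrs b x xs) ≤ n
  degree-≤ h u ¬c b x∈ =
    ≮⇒≥ λ l → ¬c (chain-step b x∈ (h _ (nbrs-unique b _ u) l))

  unavoidable-double : ∀ {k n} → Unavoidable k (suc n) → Unavoidable (suc k) (2 * suc n)
  unavoidable-double {k} {n} h []          u ()
  unavoidable-double {k} {n} h xs@(x ∷ _) u l with chain? (suc k) xs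
  ... | yes c = c
  ... | no ¬c = contradiction l (<⇒≱ (begin-strict
    length xs                                                     ≡⟨ degrees true u (here refl) ⟨
    suc (length (nbrs true x xs) + length (nbrs false x xs))      ≤⟨ s≤s (+-mono-≤ (d true) (d false)) ⟩
    suc (n + n)                                                   <⟨ n<1+n _ ⟩
    suc (suc (n + n))                                             ≡⟨ cong suc (+-suc n n) ⟨
    suc n + suc n                                                 ≡⟨ cong (λ k → suc n + k) (+-identityʳ (suc n)) ⟨
    2 * suc n                                                     ∎))
    where
    open ≤-Reasoning
    d : ∀ b → length (nbrs b x xs) ≤ n
    d b = degree-≤ h u ¬c b (here refl)

  -- Without a chain every degree would equal the odd number n, on an odd
  -- number 2 n + 1 of vertices.
  unavoidable-even : ∀ {k n} → 2 ∣ suc n → Unavoidable k (suc n) →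
                     Unavoidable (suc k) (suc (n + n))
  unavoidable-even {k} {n} even h xs u l with chain? (suc k) xs
  ... | yes c = c
  ... | no ¬c = contradiction (∣1⇒≡1 (∣m+n∣m⇒∣n (subst (2 ∣_) (+-comm 1 n) even) 2∣n)) λ ()
    where
    d≤ : ∀ b {x} → x ∈ xs → length (nbrs b x xs) ≤ n
    d≤ = degree-≤ h u ¬c

    n≤d : ∀ {x} → x ∈ xs → n ≤ length (nbrs true x xs)
    n≤d x∈ = +-cancelʳ-≤ n n _ (≤-trans
      (≤-pred (≤-trans l (≤-reflexive (sym (degrees true u x∈)))))
      (+-monoʳ-≤ _ (d≤ false x∈)))

    order : ∀ {x} → x ∈ xs → length xs ≡ suc (n + n)
    order x∈ = ≤-antisym
      (≤-trans (≤-reflexive (sym (degrees true u x∈))) (s≤s (+-mono-≤ (d≤ true x∈) (d≤ false x∈)))) l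

    size : length xs ≡ suc (n + n)
    size = order (proj₂ (nonempty xs (≤-trans (s≤s z≤n) l)))

    -- All degrees equal `n`, so this is the degree sum over `suc (n + n)` vertices, with the
    -- product unfolded.
    total : 2 ∣ n + (n + n) * n
    total = subst (2 ∣_)
      (trans (≤-antisym (edgeCount-≤ xs (d≤ true)) (edgeCount-≥ xs n≤d)) (cong (_* n) size))
      (handshake true xs)

    2∣n : 2 ∣ n
    2∣n = ∣m+n∣m⇒∣n (subst (2 ∣_) (+-comm n _) total)
      (∣m⇒∣m*n n (2∣n+n n))

  unavoidable-1 : Unavoidable 1 1
  unavoidable-1 (x ∷ xs) u l = here (true , tt)

  -- The bound 1 for order 1 doubles to 2 for order 2; as 2 is even, the next bound is 2 · 2 - 1.
  unavoidable-3 : Unavoidable 3 3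
  unavoidable-3 = unavoidable-even (divides 1 refl) (unavoidable-double unavoidable-1)

  -- Soundness of the search.

  module Placement (f : Fin 9 → V) (f-injective : ∀ {i j} → f i ≡ f j → i ≡ j)
                   {xs : List V} (f∈xs : ∀ i → f i ∈ xs) (no-5 : ¬ Chain 5 xs)
                   (no-4 : ¬ Chain 4 (map f pentagon)) where

    CellAgrees : Fin 9 → Fin 9 → Maybe Bool → Set
    CellAgrees i j = Maybe.All λ b → Joined b (f i) (f j)

    record RowAgrees (i : Fin 9) (r : Vec (Maybe Bool) 9) : Set where
      constructor row
      field cell : ∀ j → CellAgrees i j (lookup r j)
    open RowAgrees

    record Agrees (M : PartialColouring 9) : Set where
      constructor table
      field rows : ∀ i → RowAgrees i (lookup M i)
    open Agrees

    colour-agrees : ∀ {M b i j} → Agrees M → Joined b (f i) (f j) → Agrees (colour i j b M)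
    colour-agrees {M} {b} {i} {j} M✓ ij =
      table (updateAt-all RowAgrees M′ j (rows M′✓) (row
        (updateAt-all (CellAgrees j) (lookup M′ j) i (cell (rows M′✓ j)) (Maybe.just (joined-sym ij)))))
      where
      M′ : PartialColouring 9
      M′ = updateAt M i λ r → updateAt r j (const (just b))

      M′✓ : Agrees M′
      M′✓ = table (updateAt-all RowAgrees M i (rows M✓) (row
              (updateAt-all (CellAgrees i) (lookup M i) j (cell (rows M✓ i)) (Maybe.just ij))))

    row-joined : ∀ {i r b k} → RowAgrees i r → T (is b (lookup r k)) → Joined b (f i) (f k)
    row-joined {r = r} {b} {k} r✓ t =
      Maybe.drop-just (subst (CellAgrees _ k) (is-just b (lookup r k) t) (cell r✓ k))

    three-chain : ∀ {ks ys} → Unique ks → 2 < length ks → (∀ {k} → k ∈ ks → f k ∈ ys) → Chain 3 ys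
    three-chain {ks} u l h = chain-mono 3
      (λ y∈ → let k , k∈ , eq = ∈-map⁻ f y∈ in subst (_∈ _) (sym eq) (h k∈))
      (unavoidable-3 (map f ks) (Unique.map⁺ f-injective u)
                     (subst (2 <_) (sym (length-map f ks)) l))

    ¬overfull : ∀ {a b c u v r s} → Joined a (f u) (f v) → RowAgrees u r → RowAgrees v s →
                ¬ T (overfull a b c r s)
    ¬overfull {a} {b} {c} {u} {v} {r} {s} uv r✓ s✓ t
      with e , l ← ∧-split (is a (just b) ∨ is a (just c)) t
         | ks , uks , len , h ← count-witnesses (λ x y → is b x ∧ is c y) r s
      with big ← subst (2 <_) (sym len) (<ᵇ⇒< 2 _ l)
         | both ← (λ {k} (k∈ : k ∈ ks) → ∧-split (is b (lookup r k)) (All.lookup h k∈))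
      with ∨-split (is a (just b)) e
    -- In colour `b`, `u` is joined to `v` and to the three vertices, so `u` heads the chain and `v`
    -- follows in colour `c`. The other case exchanges `u` and `v`.
    ... | inj₁ a=b with refl ← is-just a (just b) a=b =
      no-5 (chain-step b (f∈xs u) (chain-step c (∈-nbrs⁺ (f∈xs v) uv) (three-chain uks big λ {k} k∈ →
        ∈-nbrs⁺ (∈-nbrs⁺ (f∈xs k) (row-joined r✓ (proj₁ (both k∈)))) (row-joined s✓ (proj₂ (both k∈))))))
    ... | inj₂ a=c with refl ← is-just a (just c) a=c =
      no-5 (chain-step c (f∈xs v) (chain-step b (∈-nbrs⁺ (f∈xs u) (joined-sym uv)) (three-chain uks big λ {k} k∈ →
        ∈-nbrs⁺ (∈-nbrs⁺ (f∈xs k) (row-joined s✓ (proj₂ (both k∈)))) (row-joined r✓ (proj₁ (both k∈))))))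

    ¬badTriangle : ∀ {M a i j} k → Agrees M → Joined a (f i) (f j) →
                   let r = lookup M i ; s = lookup M j in
                   ¬ T (badTriangle a (lookup r k) (lookup s k) r s (lookup M k))
    ¬badTriangle {M} {a} {i} {j} k M✓ ij t
      with lookup (lookup M i) k | cell (rows M✓ i) k | lookup (lookup M j) k | cell (rows M✓ j) k
    ... | just b | Maybe.just ik | just c | Maybe.just jk with ∨-split (overfull a b c (lookup M i) (lookup M j)) t
    ... | inj₁ t₁ = ¬overfull ij (rows M✓ i) (rows M✓ j) t₁
    ... | inj₂ t′ with ∨-split (overfull c a b (lookup M j) (lookup M k)) t′
    ... | inj₁ t₂ = ¬overfull jk (rows M✓ j) (rows M✓ k) t₂
    ... | inj₂ t₃ = ¬overfull ik (rows M✓ i) (rows M✓ k) t₃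

    ¬crowded : ∀ {b i r} → i ∈ pentagon → RowAgrees i r → ¬ T (crowded b r)
    ¬crowded {b} {i} {r} i∈ r✓ t = no-4 (chain-step b (∈-map⁺ f i∈)
      (three-chain (Unique.filter⁺ p? pentagon-unique) (<ᵇ⇒< 2 _ t) λ k∈ →
        let k∈′ , q = ∈-filter⁻ p? {xs = pentagon} k∈ in ∈-nbrs⁺ (∈-map⁺ f k∈′) (row-joined r✓ q)))
      where
      p? : ∀ k → Dec (T (is b (lookup r k)))
      p? k = T? (is b (lookup r k))

    ¬bad : ∀ {M a i j} → Agrees M → Joined a (f i) (f j) → ¬ T (bad M i j a)
    ¬bad {M} {a} {i} {j} M✓ ij t with ∨-split (crowdedPair a i j (lookup M i) (lookup M j)) t
    ... | inj₂ t₁ with k , t₂ ← Any.satisfied (Any.any⁻ _ (allFin 9) t₁) = ¬badTriangle k M✓ ij t₂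
    ... | inj₁ t₁ with i<5 , t₂ ← ∧-split (toℕ i <ᵇ 5) t₁
                  with j<5 , t₃ ← ∧-split (toℕ j <ᵇ 5) t₂
                  with ∨-split (crowded a (lookup M i)) t₃
    ... | inj₁ t₄ = ¬crowded {a} (∈-pentagon i i<5) (rows M✓ i) t₄
    ... | inj₂ t₄ = ¬crowded {a} (∈-pentagon j j<5) (rows M✓ j) t₄

    -- At each pair, follow the branch with the colour that the graph itself gives. The table keeps
    -- agreeing with the graph, so nothing bad arises, and the path ends at the empty list, where
    -- `refuted` is `false`.
    ¬refuted : ∀ {o M} → All (uncurry _≢_) o → Agrees M → ¬ T (refuted o M)
    ¬refuted {(i , j) ∷ o} {M} (i≢j ∷ o≢) M✓ t =
      [ ¬bad M′✓ ij , ¬refuted o≢ M′✓ ]′ (∨-split (bad (colour i j a M) i j a) (branch a))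
      where
      a : Bool
      a = adj (f i) (f j)

      ij : Joined a (f i) (f j)
      ij = i≢j ∘ f-injective , refl

      M′✓ : Agrees (colour i j a M)
      M′✓ = colour-agrees M✓ ij

      branch : ∀ b → T (refutedBranch i j o M b)
      branch true  = proj₁ (∧-split (refutedBranch i j o M true) t)
      branch false = proj₂ (∧-split (refutedBranch i j o M true) t)

    FJoined : Fin 9 × Fin 9 × Bool → Set
    FJoined (i , j , a) = Joined a (f i) (f j)

    initial-agrees : ∀ {es} → All FJoined es → Agrees (initial es)
    initial-agrees []      = table λ i → row λ k → subst (CellAgrees i k) (sym (lookup-blank i k)) Maybe.nothing
    initial-agrees (e ∷ h) = colour-agrees (initial-agrees h) e

    ¬initial-refuted : ∀ {es} → refuted edges (initial es) ≡ true →
                       ¬ All FJoined es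
    ¬initial-refuted {es} eq h =
      ¬refuted {M = initial es} edges-distinct (initial-agrees {es} h) (subst T (sym eq) tt)

  -- Five vertices among nine.

  without : V → List V → List V
  without y = filter λ z → ¬? (y ≟ z)

  length-without : ∀ y {xs} → Unique xs → length xs ≤ suc (length (without y xs))
  length-without y []                = z≤n
  length-without y {x ∷ xs} (x∉ ∷ u) with y ≟ x
  ... | yes refl = s≤s (≤-reflexive (cong length (sym (filter-all _ x∉))))
  ... | no  _    = s≤s (length-without y u)

  _∖_ : List V → List V → List V
  xs ∖ []       = xs
  xs ∖ (y ∷ ys) = without y xs ∖ ys

  ∖-unique : ∀ {xs} ys → Unique xs → Unique (xs ∖ ys)
  ∖-unique []       u = u
  ∖-unique (y ∷ ys) u = ∖-unique ys (Unique.filter⁺ _ u)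

  length-∖ : ∀ {xs} ys → Unique xs → length xs ≤ length (xs ∖ ys) + length ys
  length-∖ []       u = ≤-reflexive (sym (+-identityʳ _))
  length-∖ (y ∷ ys) u = ≤-trans (length-without y u)
    (≤-trans (s≤s (length-∖ ys (Unique.filter⁺ _ u))) (≤-reflexive (sym (+-suc _ _))))

  ∈-∖⁻ : ∀ {z xs} ys → z ∈ xs ∖ ys → z ∈ xs × z ∉ ys
  ∈-∖⁻ []       z∈ = z∈ , λ ()
  ∈-∖⁻ {xs = xs} (y ∷ ys) z∈ with z∈′ , z∉ ← ∈-∖⁻ ys z∈
                            with z∈″ , y≢z ← ∈-filter⁻ (λ z → ¬? (y ≟ z)) {xs = xs} z∈′ =
    z∈″ , λ { (here z≡y) → y≢z (sym z≡y) ; (there z∈ys) → z∉ z∈ys }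

  -- Vertices 0 to 4 of the search are s, p, q, r, t.
  ¬star : ∀ {xs ys s p q r t} → Unique xs → 9 ≤ length xs → ¬ Chain 5 xs → ¬ Chain 4 ys → ys ⊆ xs →
          All (_∈ ys) (s ∷ p ∷ q ∷ r ∷ t ∷ []) → p ≢ q → r ≢ t →
          Joined true s p → Joined true s q → Joined false s r → Joined false s t →
          ¬ (Joined true p r ⊎ (Joined false p r × Joined false p t))
  ¬star {xs} {ys} {s} {p} {q} {r} {t} u l no-5 no-4 ys⊆xs five∈ p≢q r≢t sp sq sr st prt =
    -- Removing five of at least nine vertices leaves the four further ones that the search
    -- requires.
    complete (xs ∖ five) (+-cancelʳ-≤ 5 4 _ (≤-trans l (length-∖ five u))) (∖-unique five u) (∈-∖⁻ five)
    where
    five : List V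
    five = s ∷ p ∷ q ∷ r ∷ t ∷ []

    apart : ∀ {x y} → Joined true s x → Joined false s y → x ≢ y
    apart sx sx′ refl = joined-clash true sx sx′

    five-unique : Unique five
    five-unique = (proj₁ sp ∷ proj₁ sq ∷ proj₁ sr ∷ proj₁ st ∷ [])
                ∷ (p≢q ∷ apart sp sr ∷ apart sp st ∷ [])
                ∷ (apart sq sr ∷ apart sq st ∷ [])
                ∷ (r≢t ∷ []) ∷ [] ∷ []

    complete : ∀ zs → 4 ≤ length zs → Unique zs → (∀ {z} → z ∈ zs → z ∈ xs × z ∉ five) → ⊥
    complete (_ ∷ [])         (s≤s ())
    complete (_ ∷ _ ∷ [])     (s≤s (s≤s ()))
    complete (_ ∷ _ ∷ _ ∷ []) (s≤s (s≤s (s≤s ())))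
    complete zs@(_ ∷ _ ∷ _ ∷ _ ∷ _) _ zs-unique zs∈ =
      [ (λ pr → ¬initial-refuted {adjacent} adjacent-refuted (pr ∷ star-joined))
      , (λ (pr , pt) → ¬initial-refuted {nonadjacent} nonadjacent-refuted (pr ∷ pt ∷ star-joined)) ]′ prt
      where
      -- The five come first, at the positions listed in `pentagon`.
      nine : List V
      nine = five ++ take 4 zs

      nine-unique : Unique nine
      nine-unique = Unique.++⁺ five-unique (Unique.take⁺ 4 zs-unique)
        λ (z∈five , z∈zs) → proj₂ (zs∈ (take-⊆ 4 zs z∈zs)) z∈five

      nine∈ : ∀ i → List.lookup nine i ∈ xs
      nine∈ i = All.lookup
        (All.++⁺ (All.map ys⊆xs five∈) (All.take⁺ 4 (All.tabulate (proj₁ ∘ zs∈))))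
        (∈-lookup {xs = nine} i)

      open Placement (List.lookup nine) (lookup-injective nine-unique _ _) nine∈ no-5
             (λ c → no-4 (chain-mono 4 (λ z∈ → All.lookup five∈ z∈) c))

      star-joined : All FJoined star
      star-joined = sp ∷ sq ∷ sr ∷ st ∷ []

  -- If the first five vertices of the list had no chain of length 4, the first of them would have
  -- two neighbours and two non-neighbours there. One of the two search starts then applies, which
  -- `¬star` excludes.
  five-chain : ∀ {xs ys} → Unique xs → 9 ≤ length xs → ¬ Chain 5 xs →
               Unique ys → ys ⊆ xs → 5 ≤ length ys → Chain 4 ys
  five-chain {xs} {s ∷ ys} u l no-5 v ys⊆xs l′ with chain? 4 (take 5 (s ∷ ys))
  ... | yes c   = chain-mono 4 (take-⊆ 5 (s ∷ ys)) c
  ... | no no-4 with two true | two false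
    where
    zs : List V
    zs = take 5 (s ∷ ys)

    zs-unique : Unique zs
    zs-unique = Unique.take⁺ 5 v

    d≤2 : ∀ b → length (nbrs b s zs) ≤ 2
    d≤2 b = degree-≤ unavoidable-3 zs-unique no-4 b (here refl)

    sum : ∀ b → 4 ≤ length (nbrs b s zs) + length (nbrs (not b) s zs)
    sum b = ≤-pred (≤-reflexive (trans (sym (trans (length-take 5 (s ∷ ys)) (m≤n⇒m⊓n≡m l′)))
                                       (sym (degrees b zs-unique (here refl)))))

    -- The degrees in the two colours sum to 4 and neither exceeds 2, so both equal 2.
    two : ∀ b → ∃[ x ] ∃[ y ] (x ≢ y × (x ∈ zs × Joined b s x) × (y ∈ zs × Joined b s y))
    two b = pair (nbrs b s zs) (nbrs-unique b s zs-unique) (∈-nbrs⁻ zs)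
      (+-cancelʳ-≤ 2 2 _ (≤-trans (sum b) (+-monoʳ-≤ _ (d≤2 (not b)))))
      where
      pair : ∀ {P : V → Set} ws → Unique ws → (∀ {w} → w ∈ ws → P w) → 2 ≤ length ws →
             ∃[ x ] ∃[ y ] (x ≢ y × P x × P y)
      pair (x ∷ y ∷ _) ((x≢y ∷ _) ∷ _) h _ = x , y , x≢y , h (here refl) , h (there (here refl))
      pair (_ ∷ []) _ _ (s≤s ())
  ... | p , q , p≢q , (p∈ , sp) , (q∈ , sq) | r , t , r≢t , (r∈ , sr) , (t∈ , st)
    with joined-either true (apart sp sr) | joined-either true (apart sp st)
    where
    apart : ∀ {x y} → Joined true s x → Joined false s y → x ≢ y
    apart sx sx′ refl = joined-clash true sx sx′
  ... | inj₁ pr | _       = contradiction (inj₁ pr)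
    (¬star u l no-5 no-4 (ys⊆xs ∘ take-⊆ 5 (s ∷ ys))
       (here refl ∷ p∈ ∷ q∈ ∷ r∈ ∷ t∈ ∷ []) p≢q r≢t sp sq sr st)
  ... | inj₂ _  | inj₁ pt = contradiction (inj₁ pt)
    -- Exchanging `r` and `t` reduces this to the previous case.
    (¬star u l no-5 no-4 (ys⊆xs ∘ take-⊆ 5 (s ∷ ys))
       (here refl ∷ p∈ ∷ q∈ ∷ t∈ ∷ r∈ ∷ []) p≢q (r≢t ∘ sym) sp sq st sr)
  ... | inj₂ pr | inj₂ pt = contradiction (inj₂ (pr , pt))
    (¬star u l no-5 no-4 (ys⊆xs ∘ take-⊆ 5 (s ∷ ys))
       (here refl ∷ p∈ ∷ q∈ ∷ r∈ ∷ t∈ ∷ []) p≢q r≢t sp sq sr st)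

  -- The bounds for orders 5 and 6.

  degree-≤-4 : ∀ {xs} → Unique xs → 9 ≤ length xs → ¬ Chain 5 xs →
               ∀ b {x} → x ∈ xs → length (nbrs b x xs) ≤ 4
  degree-≤-4 u l no-5 b x∈ = ≮⇒≥ λ l′ →
    no-5 (chain-step b x∈ (five-chain u l no-5 (nbrs-unique b _ u) (nbrs-⊆ b _ _) l′))

  -- Degrees of at most 4 in both colours leave room for only 1 + 4 + 4 = 9 vertices.
  unavoidable-5 : Unavoidable 5 10
  unavoidable-5 xs u l with chain? 5 xs
  ... | yes c   = c
  ... | no no-5 with x , x∈ ← nonempty xs (≤-trans (s≤s z≤n) l) =
    contradiction (≤-trans l (≤-trans (≤-reflexive (sym (degrees true u x∈)))
      (s≤s (+-mono-≤ (d≤4 true x∈) (d≤4 false x∈))))) 1+n≰n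
    where d≤4 = degree-≤-4 u (≤-trans (n≤1+n 9) l) no-5

  unavoidable-6 : Unavoidable 6 18
  unavoidable-6 xs u l with chain? 6 xs
  ... | yes c   = c
  ... | no no-6 with v , v∈ ← nonempty xs (≤-trans (s≤s z≤n) l) =
    ⊥-elim ([ fewer-than-9 true v∈ , fewer-than-9 false v∈ ]′ (large v∈))
    where
    d≤9 : ∀ b {x} → x ∈ xs → length (nbrs b x xs) ≤ 9
    d≤9 = degree-≤ unavoidable-5 u no-6

    -- At least 17 other vertices are divided between two colours, so one colour gets 9 of them.
    large : ∀ {v} → v ∈ xs → 9 ≤ length (nbrs true v xs) ⊎ 9 ≤ length (nbrs false v xs)
    large {v} v∈ with 9 ≤? length (nbrs true v xs)
    ... | yes p = inj₁ p
    ... | no ¬p = inj₂ (+-cancelˡ-≤ 8 9 _ (≤-trans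
      (≤-pred (≤-trans l (≤-reflexive (sym (degrees true u v∈)))))
      (+-monoˡ-≤ _ (≤-pred (≰⇒> ¬p)))))

    -- Arguing for an arbitrary colour `b` replaces passing to the complement. The edges of colour
    -- `b` between `R` and `W` are counted from both sides.
    fewer-than-9 : ∀ b {v} → v ∈ xs → ¬ 9 ≤ length (nbrs b v xs)
    fewer-than-9 b {v} v∈ l′ = contradiction (begin
      40                ≤⟨ *-monoˡ-≤ 5 W≥8 ⟩
      length W * 5      ≤⟨ edgeCount-≥ W 5≤d ⟩
      edgeCount b W R   ≡⟨ edgeCount-comm b W R ⟩
      edgeCount b R W   ≤⟨ edgeCount-≤ R d≤4 ⟩
      length R * 4      ≤⟨ *-monoˡ-≤ 4 (d≤9 b v∈) ⟩
      36                ∎) (<⇒≱ (m≤m+n 37 3))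
      where
      open ≤-Reasoning

      R W : List V
      R = nbrs b v xs
      W = nbrs (not b) v xs

      R-unique : Unique R
      R-unique = nbrs-unique b v u

      no-5 : ¬ Chain 5 R
      no-5 = no-6 ∘ chain-step b v∈

      W≥8 : 8 ≤ length W
      W≥8 = +-cancelˡ-≤ 9 8 _ (≤-trans (≤-pred (≤-trans l (≤-reflexive (sym (degrees b u v∈)))))
                                        (+-monoˡ-≤ _ (d≤9 b v∈)))

      -- Of the at least 8 other vertices of `R`, at most 4 are joined to `x` in the opposite
      -- colour.
      4≤d : ∀ {x} → x ∈ R → 4 ≤ length (nbrs b x R)
      4≤d x∈ = +-cancelʳ-≤ 4 4 _ (≤-trans
        (≤-pred (≤-trans l′ (≤-reflexive (sym (degrees b R-unique x∈)))))
        (+-monoʳ-≤ _ (degree-≤-4 R-unique l′ no-5 (not b) x∈)))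

      d≤4 : ∀ {x} → x ∈ R → length (nbrs b x W) ≤ 4
      d≤4 {x} x∈ with x∈xs , vx ← ∈-nbrs⁻ xs x∈ = +-cancelˡ-≤ 5 _ 4 (begin
        5 + length (nbrs b x W)                                          ≤⟨ +-monoˡ-≤ _ (s≤s (4≤d x∈)) ⟩
        suc (length (nbrs b x R) + length (nbrs b x W))
          -- Swapping the two filters exhibits both sets as the parts into which `v` splits the
          -- other neighbours of `x`; the `suc` accounts for `v` itself.
          ≡⟨ cong₂ (λ ys zs → suc (length ys + length zs)) (filter-comm _ _ xs) (filter-comm _ _ xs) ⟩
        suc (length (nbrs b v (nbrs b x xs)) + length (nbrs (not b) v (nbrs b x xs)))
          ≡⟨ degrees b (nbrs-unique b x u) (∈-nbrs⁺ v∈ (joined-sym vx)) ⟩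
        length (nbrs b x xs)                                             ≤⟨ d≤9 b x∈xs ⟩
        9                                                                ∎)

      5≤d : ∀ {w} → w ∈ W → 5 ≤ length (nbrs b w R)
      5≤d {w} w∈ with w∈xs , vw ← ∈-nbrs⁻ xs w∈ = +-cancelʳ-≤ 4 5 _ (begin
        9                                                   ≤⟨ l′ ⟩
        length R                                            ≡⟨ degrees-∉ b w R w∉R ⟨
        length (nbrs b w R) + length (nbrs (not b) w R)     ≤⟨ +-monoʳ-≤ _ co-degree ⟩
        length (nbrs b w R) + 4                             ∎)
        where
        w∉R : w ∉ R
        w∉R w∈R = joined-clash b (proj₂ (∈-nbrs⁻ xs w∈R)) vw

        co-degree : length (nbrs (not b) w R) ≤ 4
        -- Five vertices of `R` joined to `w` in colour `not b` would contain a chain of length 4.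
        -- Then `w` would head a chain of length 6 in colour `not b`, followed by `v` in colour `b`.
        co-degree = ≮⇒≥ λ l″ → no-6
          (chain-step (not b) w∈xs (chain-step b (∈-nbrs⁺ v∈ (joined-sym vw)) (chain-mono 4
            (λ z∈ → let z∈R , wz = ∈-nbrs⁻ R z∈ ; z∈xs , vz = ∈-nbrs⁻ xs z∈R
                    in ∈-nbrs⁺ (∈-nbrs⁺ z∈xs wz) vz)
            (five-chain R-unique l′ no-5 (nbrs-unique (not b) w R-unique) (nbrs-⊆ (not b) w R) l″))))

-- Graphs

module _ {m : ℕ} (G : Graph m) where

  open Chains Fin._≟_ (adj G) (symm G)

  -- Confining the image to `xs` lets the induction pass to neighbourhoods.
  record EmbeddedIn {s : ℕ} (xs : List (Fin m)) (H : Graph s) : Set where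
    constructor embedded
    field
      ι         : Fin s → Fin m
      injective : ∀ {i j} → ι i ≡ ι j → i ≡ j
      preserves : ∀ i j → adj G (ι i) (ι j) ≡ adj H i j
      ι∈xs      : ∀ i → ι i ∈ xs

  open EmbeddedIn

  chain⇒threshold : ∀ k xs → Chain (suc k) xs →
                    ∃[ H ] (IsThreshold {suc k} H × EmbeddedIn xs H)
  chain⇒threshold zero xs c with x , x∈ , _ ← find c =
    K₁ , single ,
    embedded (λ _ → x) (λ { {zero} {zero} _ → refl }) (λ _ _ → irrefl G x) (λ _ → x∈)
  chain⇒threshold (suc k) xs c
    with x , x∈ , b , c′ ← find c
    with H , t , e ← chain⇒threshold k (nbrs b x xs) c′ =
    addVertex b H , extend b t , embedded ι′ injective′ preserves′ ι′∈
    where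
    joined : ∀ i → Joined b x (ι e i)
    joined i = proj₂ (∈-nbrs⁻ xs (ι∈xs e i))

    ι′ : Fin (suc (suc k)) → Fin m
    ι′ zero    = x
    ι′ (suc i) = ι e i

    injective′ : ∀ {i j} → ι′ i ≡ ι′ j → i ≡ j
    injective′ {zero}  {zero}  _  = refl
    injective′ {zero}  {suc j} eq = contradiction eq (proj₁ (joined j))
    injective′ {suc i} {zero}  eq = contradiction (sym eq) (proj₁ (joined i))
    injective′ {suc i} {suc j} eq = cong suc (injective e eq)

    preserves′ : ∀ i j → adj G (ι′ i) (ι′ j) ≡ adj (addVertex b H) i j
    preserves′ zero    zero    = irrefl G x
    preserves′ zero    (suc j) = proj₂ (joined j)
    preserves′ (suc i) zero    = proj₂ (joined-sym (joined i))
    preserves′ (suc i) (suc j) = preserves e i j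

    ι′∈ : ∀ i → ι′ i ∈ xs
    ι′∈ zero    = x∈
    ι′∈ (suc i) = nbrs-⊆ b x xs (ι∈xs e i)

  -- This converse makes `ContainsThreshold` decidable through `chain?`. An isomorphism merely
  -- reindexes the embedding.
  threshold⇒chain : ∀ {s} {H : Graph s} {xs} → IsThreshold H → EmbeddedIn xs H → Chain s xs
  threshold⇒chain single e = chain-step true (ι∈xs e zero) tt
  threshold⇒chain (extend b t) e = chain-step b (ι∈xs e zero) (threshold⇒chain t record
    { ι         = ι e ∘ suc
    ; injective = Fin.suc-injective ∘ injective e
    ; preserves = λ i j → preserves e (suc i) (suc j)
    ; ι∈xs      = λ i → ∈-nbrs⁺ (ι∈xs e (suc i))
                    ((λ eq → Fin.0≢1+n (injective e eq)) , preserves e zero (suc i))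
    })
  threshold⇒chain (iso (φ , φ-preserves) t) e = threshold⇒chain t record
    { ι         = ι e ∘ Inverse.to φ
    ; injective = Injection.injective (↔⇒↣ φ) ∘ injective e
    ; preserves = λ i j → trans (preserves e _ _) (φ-preserves i j)
    ; ι∈xs      = λ i → ι∈xs e (Inverse.to φ i)
    }

  chain⇒contains : ∀ k → Chain (suc k) (allFin m) → ContainsThreshold (suc k) G
  chain⇒contains k c with H , t , e ← chain⇒threshold k (allFin m) c =
    H , t , mk↣ (injective e) , preserves e

  contains⇒chain : ∀ k → ContainsThreshold (suc k) G → Chain (suc k) (allFin m)
  contains⇒chain k (H , t , ι , p) =
    threshold⇒chain t (embedded (Injection.to ι) (Injection.injective ι) p (λ i → ∈-allFin _))

  contains? : ∀ k → Dec (ContainsThreshold (suc k) G)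
  contains? k = map′ (chain⇒contains k) (contains⇒chain k) (chain? (suc k) (allFin m))

  unavoidable⇒contains : ∀ k → Unavoidable (suc k) m → ContainsThreshold (suc k) G
  unavoidable⇒contains k h = chain⇒contains k
    (h (allFin m) (Unique.allFin⁺ m) (≤-reflexive (sym (length-tabulate id))))

-- Existence of the minimum.

toGraph : ∀ {m} → Subset (m * m) → Graph m
toGraph p .adj    i j = not (does (i Fin.≟ j)) ∧ (lookup p (combine i j) ∧ lookup p (combine j i))
toGraph p .symm   i j = cong₂ _∧_
  (cong not (does-⇔ (mk⇔ sym sym) (i Fin.≟ j) (j Fin.≟ i)))
  (Bool.∧-comm (lookup p (combine i j)) _)
toGraph p .irrefl i = cong
  (λ b → not b ∧ (lookup p (combine i i) ∧ lookup p (combine i i)))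
  (dec-true (i Fin.≟ i) refl)

fromGraph : ∀ {m} → Graph m → Subset (m * m)
fromGraph {m} G = tabulate (uncurry (adj G) ∘ remQuot m)

toGraph-fromGraph : ∀ {m} (G : Graph m) i j → adj (toGraph (fromGraph G)) i j ≡ adj G i j
toGraph-fromGraph {m} G i j with i Fin.≟ j
... | yes refl = sym (irrefl G i)
... | no  _    = trans (cong₂ _∧_ (bit i j) (trans (bit j i) (symm G j i))) (Bool.∧-idem _)
  where
  bit : ∀ i j → lookup (fromGraph G) (combine i j) ≡ adj G i j
  bit i j = trans (lookup∘tabulate _ (combine i j)) (cong (uncurry (adj G)) (Fin.remQuot-combine i j))

-- Every subset of the pairs yields a graph, since `toGraph` symmetrises it and drops the diagonal,
-- and every graph arises up to pointwise equality of `adj`. Hence a finite search over subsets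
-- decides the claim.
allContain? : ∀ k m → Dec ((G : Graph m) → ContainsThreshold (suc k) G)
allContain? k m with anySubset? (λ p → ¬? (contains? (toGraph {m} p) k))
... | yes (p , ¬c) = no λ h → ¬c (h (toGraph p))
... | no  none     = yes λ G →
  let H , t , ι , p = decidable-stable (contains? (toGraph (fromGraph G)) k)
                                       (λ ¬c → none (fromGraph G , ¬c))
  in H , t , ι , λ i j → trans (sym (toGraph-fromGraph G _ _)) (p i j)

minimum : ∀ {P : ℕ → Set} → (∀ n → Dec (P n)) → ∀ n → P n → ∃[ k ] (k ≤ n × IsMinimum P k)
minimum {P} P? = <-rec _ step
  where
  step : ∀ n → (∀ {i} → i < n → P i → ∃[ k ] (k ≤ i × IsMinimum P k)) →
         P n → ∃[ k ] (k ≤ n × IsMinimum P k)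
  step n rec p with anyUpTo? P? n
  ... | yes (i , i<n , q) = let k , k≤i , min = rec i<n q in k , ≤-trans k≤i (<⇒≤ i<n) , min
  ... | no  none          = n , ≤-refl , p , λ i q → ≮⇒≥ λ i<n → none (i , i<n , q)

-- The recursion from order 6 and the ceiling.

Forces : ℕ → ℕ → Set
Forces k n = ∀ {m} (G : Graph m) → Chains.Unavoidable Fin._≟_ (adj G) (symm G) k n

-- For s = 6 + k, n is the least integer above (13 / 48) 2ˢ = 13 · 2ˢ⁻⁴ / 3.
IsBound : ℕ → ℕ → Set
IsBound k n = (2 ∣ n × 3 * n ≡ 13 * 2 ^ (2 + k) + 2) ⊎ 3 * n ≡ 13 * 2 ^ (2 + k) + 1

-- The two forms of `IsBound` alternate: an even bound N is followed by 2 N - 1, and a bound of the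
-- second form by 2 N, which is even again. The start is 3 · 18 = 13 · 4 + 2.
forces-bound : ∀ k → ∃[ n ] (Forces (6 + k) (suc n) × IsBound k (suc n))
forces-bound zero =
  17 , (λ G → Chains.unavoidable-6 Fin._≟_ (adj G) (symm G)) , inj₁ (divides 9 refl , refl)
forces-bound (suc k) with forces-bound k
... | n , h , inj₁ (even , eq) =
  n + n , (λ G → Chains.unavoidable-even Fin._≟_ (adj G) (symm G) even (h G)) ,
  -- Adding 3 to both sides of the claim about 2 N - 1 avoids subtraction.
  inj₂ (+-cancelʳ-≡ 3 _ _ (begin
    3 * suc (n + n) + 3              ≡⟨ solve 1 (λ n → con 3 :* (con 1 :+ (n :+ n)) :+ con 3 :=
                                          con 2 :* (con 3 :* (con 1 :+ n))) refl n ⟩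
    2 * (3 * suc n)                  ≡⟨ cong (2 *_) eq ⟩
    2 * (13 * 2 ^ (2 + k) + 2)       ≡⟨ solve 1 (λ x → con 2 :* (con 13 :* x :+ con 2) :=
                                          con 13 :* (con 2 :* x) :+ con 1 :+ con 3) refl (2 ^ (2 + k)) ⟩
    13 * 2 ^ (3 + k) + 1 + 3         ∎))
  where open ≡-Reasoning
... | n , h , inj₂ eq =
  -- The successor of this number is what `2 * suc n` reduces to.
  n + suc (n + 0) , (λ G → Chains.unavoidable-double Fin._≟_ (adj G) (symm G) (h G)) ,
  inj₁ (divides (suc n) (*-comm 2 (suc n)) , (begin
    3 * (2 * suc n)                  ≡⟨ solve 1 (λ n → con 3 :* (con 2 :* (con 1 :+ n)) :=
                                          con 2 :* (con 3 :* (con 1 :+ n))) refl n ⟩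
    2 * (3 * suc n)                  ≡⟨ cong (2 *_) eq ⟩
    2 * (13 * 2 ^ (2 + k) + 1)       ≡⟨ solve 1 (λ x → con 2 :* (con 13 :* x :+ con 1) :=
                                          con 13 :* (con 2 :* x) :+ con 2) refl (2 ^ (2 + k)) ⟩
    13 * 2 ^ (3 + k) + 2             ∎))
  where open ≡-Reasoning

-- If the ceiling c were below `N`, then 13 x ≤ 48 c and 48 (c + 1) ≤ 48 N would contradict the
-- hypothesis.
≤-ceiling : ∀ {N x} → 48 * N < 13 * x + 48 → + N ℤ.≤ ceiling ((+ 13 / 48) ℚᵘ.* (+ x / 1))
≤-ceiling {N} {x} h = ℤ.≮⇒≥ λ c<N → <⇒≱ h (begin
  13 * x + 48   ≡⟨ +-comm (13 * x) 48 ⟩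
  48 + 13 * x   ≤⟨ ℤ.drop‿+≤+ (ℤ.≤-trans (ℤ.+-monoʳ-≤ (+ 48) 13x≤48c) (48+48c≤48N c<N)) ⟩
  N * 48        ≡⟨ *-comm N 48 ⟩
  48 * N        ∎)
  where
  open ≤-Reasoning

  c : ℤ
  c = ceiling ((+ 13 / 48) ℚᵘ.* (+ x / 1))

  -- The ceiling is minus the floor of the negated fraction; `q` is that floor.
  q : ℤ
  q = (ℤ.- (+ 13 ℤ.* + x)) ℤ./ + 48

  13x≤48c : + (13 * x) ℤ.≤ c ℤ.* + 48
  13x≤48c = subst₂ ℤ._≤_ (trans (ℤ.neg-involutive _) (sym (ℤ.pos-* 13 x))) (ℤ.neg-distribˡ-* q (+ 48))
    (ℤ.neg-mono-≤ (ℤ.[n/d]*d≤n (ℤ.- (+ 13 ℤ.* + x)) (+ 48)))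

  48+48c≤48N : c ℤ.< + N → + 48 ℤ.+ c ℤ.* + 48 ℤ.≤ + (N * 48)
  48+48c≤48N c<N = subst₂ ℤ._≤_ (ℤ.suc-* c (+ 48)) (sym (ℤ.pos-* N 48))
    (ℤ.*-monoʳ-≤-nonNeg (+ 48) (ℤ.i<j⇒suc[i]≤j c<N))

-- The excess of at most 2 in `3 * n` becomes at most 32 after multiplication by 16, still below 48.
bound-< : ∀ k {n} → IsBound k n → 48 * n < 13 * 2 ^ (6 + k) + 48
bound-< k {n} h = begin-strict
  48 * n                          ≡⟨ *-assoc 16 3 n ⟩
  16 * (3 * n)                    ≤⟨ *-monoʳ-≤ 16 (3n≤ h) ⟩
  16 * (13 * 2 ^ (2 + k) + 2)     ≡⟨ solve 1 (λ x → con 16 :* (con 13 :* x :+ con 2) :=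
                                       con 13 :* (con 2 :* (con 2 :* (con 2 :* (con 2 :* x)))) :+ con 32)
                                       refl (2 ^ (2 + k)) ⟩
  13 * 2 ^ (6 + k) + 32           <⟨ +-monoʳ-< (13 * 2 ^ (6 + k)) (m≤m+n 33 15) ⟩
  13 * 2 ^ (6 + k) + 48           ∎
  where
  open ≤-Reasoning

  3n≤ : IsBound k n → 3 * n ≤ 13 * 2 ^ (2 + k) + 2
  3n≤ (inj₁ (_ , eq)) = ≤-reflexive eq
  3n≤ (inj₂ eq)       = ≤-trans (≤-reflexive eq) (+-monoʳ-≤ _ (n≤1+n 1))

corollary3p12 : ∀ (s : ℕ) → 6 ≤ s →
    ∃[ n ] (n IsR₂′Of s × + n ℤ.≤ ceiling ((+ 13 / 48) ℚᵘ.* (+ (2 ^ s) / 1)))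
corollary3p12 s 6≤s =
  let k , 6+k≡s = m≤n⇒∃[o]m+o≡n 6≤s
      n , forces , size = forces-bound k
      r , r≤n , min = minimum (allContain? (5 + k)) (suc n)
        (λ G → unavoidable⇒contains G (5 + k) (forces G))
  in subst (λ s → ∃[ n ] (n IsR₂′Of s × + n ℤ.≤ ceiling ((+ 13 / 48) ℚᵘ.* (+ (2 ^ s) / 1)))) 6+k≡s
       (r , min , ℤ.≤-trans (ℤ.+≤+ r≤n) (≤-ceiling {suc n} {2 ^ (6 + k)} (bound-< k size)))
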